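{- Let $S$ be a specular set on a finite alphabet $A$ and let $\mathcal{G}$ be its parity graph. For $i,j\in\{0,1\}$ let $S_{i,j}$ be the set of words in $S$ which are the label of a path from $i$ to $j$ in $\mathcal{G}$. Then: (1) The family $(S_{i,j}\setminus\{\varepsilon\})_{0\le i,j\le1}$ is a partition of $S\setminus\{\varepsilon\}$. (2) For $u\in S_{i,j}\setminus\{\varepsilon\}$ and $v\in S_{k,\ell}\setminus\{\varepsilon\}$, if $uv\in S$, then $j=k$. (3) $S_{0,0}\cup S_{1,1}$ is the set of even words of $S$. (4) $S_{i,j}^{ -1}=S_{1-j,1-i}$ for all $i,j\in\{0,1\}$.
   Context: Words are over a finite alphabet $A$; $\varepsilon$ is the empty word. A set $S$ of words on $A$ is factorial if it contains $A$ and all the factors of its elements. For $w\in S$ let $L(w)=\{a\in A\mid aw\in S\}$, $R(w)=\{a\in A\mid wa\in S\}$, $B(w)=\{(a,b)\in A\times A\mid awb\in S\}$. A factorial set $S$ is biextendable if $B(w)\neq\emptyset$ for all $w\in S$. The extension graph $\mathcal{E}(w)$ is the undirected graph whose vertex set is the disjoint union of $L(w)$ and $R(w)$, the copy of $a\in L(w)$ being denoted $1\otimes a$ and the copy of $b\in R(w)$ being denoted $b\otimes 1$, with an edge $(1\otimes a,b\otimes1)$ for each $(a,b)\in B(w)$. A biextendable set $S$ is a tree set of characteristic $c$ if $\mathcal{E}(w)$ is a tree for every nonempty $w\in S$ and $\mathcal{E}(\varepsilon)$ is a disjoint union of $c$ trees. Let $\theta$ be an involution on $A$ (possibly with fixed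 points) and let $G_\theta$ be the group generated by $A$ with relations $a\theta(a)=1$, $a\in A$ (so $a^{ -1}=\theta(a)$). A word is reduced if it has no factor $a\theta(a)$ with $a\in A$; the inverse of a reduced word $a_1\cdots a_n$ is the reduced word $\theta(a_n)\cdots\theta(a_1)$, and for a set $Y$ of reduced words $Y^{ -1}=\{y^{ -1}\mid y\in Y\}$. A laminary set on $A$ relative to $\theta$ is a biextendable set of reduced words closed under taking inverses. A specular set is a laminary set which is a tree set of characteristic $2$. Let $\mathcal{T}_0,\mathcal{T}_1$ be the two trees forming $\mathcal{E}(\varepsilon)$. The parity graph $\mathcal{G}$ of $S$ is the directed graph with vertices $0,1$ and edges all triples $(i,a,j)$ (from $i$ to $j$ with label $a$) with $a\in A$ such that $(1\otimes b,a\otimes1)\in\mathcal{T}_i$ and $(1\otimes a,c\otimes1)\in\mathcal{T}_j$ for some $b,c\in A$. For every letter $a\in A$ there is exactly one edge labeled $a$. The empty word labels the empty path from $i$ to $i$. A letter $a$ is even if its two occurrences $1\otimes a$, $a\otimes1$ as vertices of $\mathcal{E}(\varepsilon)$ are in the same tree, and odd otherwise; a word of $S$ is even if it has an even number of (occurrences of) odd letters. A partition here means a pairwise disjoint family with the given union; some members may be empty. -}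

module Defs where

open import Data.Empty using (⊥)
open import Data.Fin using (Fin; _≟_)
open import Data.List using (List; []; _∷_; [_]; _++_; _∷ʳ_; length; map; reverse; filter)
open import Data.List.Properties using (++-identityʳ)
open import Data.List.Relation.Unary.Linked using (Linked)
open import Data.List.Relation.Unary.Unique.Propositional using (Unique)
open import Data.Nat using (ℕ; _≤_)
open import Data.Nat.Divisibility using (_∣_)
open import Data.Product using (_×_; _,_; ∃; ∃-syntax)
open import Function.Bundles using (_⇔_; Equivalence)
open import Level using (0ℓ)
open import Relation.Binary.Construct.Closure.ReflexiveTransitive using (Star)
open import Relation.Binary.PropositionalEquality using (_≡_; _≢_; refl; sym; trans; subst)
open import Relation.Nullary using (¬_; yes; no)
open import Relation.Nullary.Decidable using (decidable-stable; ¬?)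
open import Relation.Unary using (Pred; Decidable; _∈_; _≐_; ⋃) renaming (_⊥_ to _disjointFrom_)

-- A simple undirected graph whose vertices form a subset of V, so that
-- the subgraphs of a graph are graphs on the same type V.
record Graph (V : Set) : Set₁ where
  field
    Vertex     : Pred V 0ℓ
    Adj        : V → V → Set
    adj-sym    : ∀ {u v} → Adj u v → Adj v u
    adj-irrefl : ∀ {v} → ¬ Adj v v
    adj-vertex : ∀ {u v} → Adj u v → Vertex u × Vertex v

open Graph public

module _ {V : Set} where

  Connected : Graph V → Set
  Connected G = ∀ {u v} → Vertex G u → Vertex G v → Star (Adj G) u v

  -- The closed walk x, vs, x is a cycle: it has at least three vertices,
  -- all of them distinct.
  IsCycle : Graph V → V → List V → Set
  IsCycle G x vs =
    Unique (x ∷ vs) × 3 ≤ length (x ∷ vs) × Linked (Adj G) (x ∷ vs ∷ʳ x)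

  Acyclic : Graph V → Set
  Acyclic G = ∀ x vs → ¬ IsCycle G x vs

  -- Trees are nonempty, so that the number of trees in a disjoint union
  -- is its number of connected components.
  record IsTree (G : Graph V) : Set where
    field
      nonempty  : ∃ (Vertex G)
      connected : Connected G
      acyclic   : Acyclic G

  record IsDisjointUnionOfTrees {c : ℕ} (G : Graph V) (T : Fin c → Graph V) : Set where
    field
      trees    : ∀ i → IsTree (T i)
      disjoint : ∀ {i j} → i ≢ j → Vertex (T i) disjointFrom Vertex (T j)
      vertices : ∀ {v} → Vertex G v ⇔ (∃[ i ] Vertex (T i) v)
      edges    : ∀ {u v} → Adj G u v ⇔ (∃[ i ] Adj (T i) u v)

IsPartition : {I X : Set} → (I → Pred X 0ℓ) → Pred X 0ℓ → Set
IsPartition {I} F P = (⋃ I F ≐ P) × (∀ p q → p ≢ q → F p disjointFrom F q)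

Language : Set → Set₁
Language A = Pred (List A) 0ℓ

module _ {A : Set} where

  record Factorial (S : Language A) : Set where
    field
      letters : ∀ a → [ a ] ∈ S
      factors : ∀ u v w → u ++ v ++ w ∈ S → v ∈ S

  L : Language A → List A → Pred A 0ℓ
  L S w a = a ∷ w ∈ S

  R : Language A → List A → Pred A 0ℓ
  R S w b = w ∷ʳ b ∈ S

  B : Language A → List A → Pred (A × A) 0ℓ
  B S w (a , b) = a ∷ w ∷ʳ b ∈ S

  record Biextendable (S : Language A) : Set where
    field
      factorial  : Factorial S
      extendable : ∀ w → w ∈ S → ∃ (B S w)

data Copy (A : Set) : Set where
  1⊗_ : A → Copy A
  _⊗1 : A → Copy A

module _ {A : Set} (S : Language A) where

  ExtVertex : List A → Pred (Copy A) 0ℓ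
  ExtVertex w (1⊗ a) = a ∈ L S w
  ExtVertex w (b ⊗1) = b ∈ R S w

  ExtAdj : List A → Copy A → Copy A → Set
  ExtAdj w (1⊗ a) (b ⊗1) = (a , b) ∈ B S w
  ExtAdj w (b ⊗1) (1⊗ a) = (a , b) ∈ B S w
  ExtAdj w (1⊗ _) (1⊗ _) = ⊥
  ExtAdj w (_ ⊗1) (_ ⊗1) = ⊥

module _ {A : Set} {S : Language A} (F : Factorial S) where
  open Factorial F

  private
    B⇒L : ∀ w a b → (a , b) ∈ B S w → a ∈ L S w
    B⇒L w a b p = factors [] (a ∷ w) [ b ] p

    B⇒R : ∀ w a b → (a , b) ∈ B S w → b ∈ R S w
    B⇒R w a b p =
      factors [ a ] (w ∷ʳ b) []
        (subst (λ z → a ∷ z ∈ S) (sym (++-identityʳ (w ∷ʳ b))) p)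

  extensionGraph : List A → Graph (Copy A)
  extensionGraph w = record
    { Vertex     = ExtVertex S w
    ; Adj        = ExtAdj S w
    ; adj-sym    = λ {u} {v} → adj-sym′ u v
    ; adj-irrefl = λ {v} → adj-irrefl′ v
    ; adj-vertex = λ {u} {v} → adj-vertex′ u v
    }
    where
    adj-sym′ : ∀ u v → ExtAdj S w u v → ExtAdj S w v u
    adj-sym′ (1⊗ _) (_ ⊗1) p = p
    adj-sym′ (_ ⊗1) (1⊗ _) p = p

    adj-irrefl′ : ∀ v → ¬ ExtAdj S w v v
    adj-irrefl′ (1⊗ _) ()
    adj-irrefl′ (_ ⊗1) ()

    adj-vertex′ : ∀ u v → ExtAdj S w u v → ExtVertex S w u × ExtVertex S w v
    adj-vertex′ (1⊗ a) (b ⊗1) p = B⇒L w a b p , B⇒R w a b p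
    adj-vertex′ (b ⊗1) (1⊗ a) p = B⇒R w a b p , B⇒L w a b p

record IsTreeSet {A : Set} (c : ℕ) (S : Language A) : Set₁ where
  field
    biextendable : Biextendable S
  open Biextendable biextendable public
  field
    tree   : ∀ w → w ∈ S → w ≢ [] → IsTree (extensionGraph factorial w)
    forest : ∃[ T ] IsDisjointUnionOfTrees {c = c} (extensionGraph factorial []) T

module _ {A : Set} (θ : A → A) where

  Reduced : Pred (List A) 0ℓ
  Reduced w = ∀ u a v → w ≢ u ++ a ∷ θ a ∷ v

  inverse : List A → List A
  inverse w = reverse (map θ w)

  Inverses : Language A → Language A
  Inverses Y w = ∃[ y ] (y ∈ Y × w ≡ inverse y)

  record IsLaminary (S : Language A) : Set where
    field
      biextendable   : Biextendable S
      reduced        : ∀ w → w ∈ S → Reduced w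
      inverse-closed : ∀ w → w ∈ S → inverse w ∈ S

  record IsSpecular (S : Language A) : Set₁ where
    field
      laminary : IsLaminary S
      treeSet  : IsTreeSet 2 S

-- Q is the set of vertices; E i a j says that (i , a , j) is an edge.
LabelledGraph : Set → Set → Set₁
LabelledGraph Q A = Q → A → Q → Set

data Path {Q A : Set} (E : LabelledGraph Q A) : Q → List A → Q → Set where
  []  : ∀ {i} → Path E i [] i
  _∷_ : ∀ {i j k a w} → E i a j → Path E j w k → Path E i (a ∷ w) k

module _ {A : Set} (T : Fin 2 → Graph (Copy A)) where

  parityGraph : LabelledGraph (Fin 2) A
  parityGraph i a j =
    (∃[ b ] Adj (T i) (1⊗ b) (a ⊗1)) × (∃[ c ] Adj (T j) (1⊗ a) (c ⊗1))

  PathLabels : Language A → Fin 2 → Fin 2 → Language A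
  PathLabels S i j w = w ∈ S × Path parityGraph i w j

  EvenLetter : Pred A 0ℓ
  EvenLetter a = ∃[ i ] (Vertex (T i) (1⊗ a) × Vertex (T i) (a ⊗1))

  OddLetter : Pred A 0ℓ
  OddLetter a = ¬ EvenLetter a

module _ {A : Set} {S : Language A} (F : Factorial S) {T : Fin 2 → Graph (Copy A)}
         (D : IsDisjointUnionOfTrees (extensionGraph F []) T) where
  open IsDisjointUnionOfTrees D

  evenLetter? : Decidable (EvenLetter T)
  evenLetter? a
    with Equivalence.to (vertices {1⊗ a}) (Factorial.letters F a)
       | Equivalence.to (vertices {a ⊗1}) (Factorial.letters F a)
  ... | i , p | j , q with i ≟ j
  ...   | yes refl = yes (i , p , q)
  ...   | no i≢j   = no λ (k , p′ , q′) →
          i≢j (trans (same p p′) (sym (same q q′)))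
    where
    same : ∀ {v k l} → Vertex (T k) v → Vertex (T l) v → k ≡ l
    same {k = k} {l} x y = decidable-stable (k ≟ l) λ k≢l → disjoint k≢l (x , y)

  oddLetter? : Decidable (OddLetter T)
  oddLetter? a = ¬? (evenLetter? a)

  EvenWords : Language A
  EvenWords w = w ∈ S × 2 ∣ length (filter oddLetter? w)

{-# OPTIONS --safe #-}
-- An edge of the parity graph labelled a goes from the tree of a ⊗1 to the tree of 1⊗ a, and
-- ab ∈ S forces 1⊗ a and b ⊗1 to lie in the same tree, so that a nonempty word of S labels
-- exactly one path.  This gives (1) and (2), and (3) follows because exactly the odd letters
-- change the vertex.  For (4), the map 1⊗ a ↦ θ(a) ⊗1, a ⊗1 ↦ 1⊗ θ(a) is an involutive
-- automorphism φ of the extension graph of ε without fixed vertices, and φ flips no edge because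
-- aθ(a) ∉ S.  An involution of a forest with these two properties moves every vertex to another
-- component: otherwise strip the ends of a non-backtracking walk p from v to φ(v) as long as they
-- are exchanged by φ; then p φ(p) is a closed non-backtracking walk, impossible in a forest.
-- Hence φ exchanges the two trees.
module Submission where

open import Defs
open import Algebra.Definitions using (Involutive)
open import Data.Empty using (⊥-elim)
open import Data.Fin using (Fin; zero; suc; opposite; _≟_)
open import Data.Fin.Properties using (inj⇒≟; opposite-involutive)
open import Data.List using (List; []; _∷_; [_]; _++_; _∷ʳ_; length; map; reverse; filter; initLast; _∷ʳ′_)
open import Data.List.Membership.Propositional using () renaming (_∈_ to _∈ₗ_)
open import Data.List.Membership.Propositional.Properties using (∈-++⁺ʳ)
open import Data.List.Properties using (++-assoc; ++-identityʳ; map-++; map-∘; map-cong; map-id; reverse-map; reverse-involutive; unfold-reverse; length-++-≤ˡ; filter-accept; filter-reject)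
open import Data.List.Relation.Unary.All as All using (All; []; _∷_)
open import Data.List.Relation.Unary.All.Properties using (++⁻ˡ)
open import Data.List.Relation.Unary.AllPairs using ([]; _∷_)
open import Data.List.Relation.Unary.Any using (here; there)
open import Data.List.Relation.Unary.Linked using (Linked; []; [-]; _∷_)
open import Data.List.Relation.Unary.Unique.Propositional using (Unique)
open import Data.Nat using (ℕ; suc; _≤_; z≤n; s≤s)
open import Data.Nat.Divisibility using (_∣_; _∣0; ∣-refl; ∣m+n∣m⇒∣n; ∣m∣n⇒∣m+n; ∣1⇒≡1)
open import Data.Nat.Properties using (≤-trans; ≤-refl; +-comm)
open import Data.Product using (_×_; _,_; ∃-syntax; proj₁; proj₂)
open import Data.Sum using (_⊎_; inj₁; inj₂)
open import Function.Bundles using (_↔_; Equivalence)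
open import Function.Properties.Inverse using (↔⇒↣)
open import Relation.Binary.Construct.Closure.ReflexiveTransitive as Star using (Star; ε; _◅_)
open import Relation.Binary.Definitions using (DecidableEquality)
open import Relation.Binary.PropositionalEquality using (_≡_; _≢_; refl; sym; trans; cong; subst; module ≡-Reasoning)
open import Relation.Nullary using (¬_; Dec; yes; no; contradiction)
open import Relation.Nullary.Decidable using (decidable-stable)
open import Relation.Unary using (_∈_; _∪_; _∖_; _≐_; ｛_｝)

-- Prefixes and first occurrences in lists.

module _ {X : Set} where

  Linked-++⁻ˡ : {R : X → X → Set} → ∀ xs {ys} → Linked R (xs ++ ys) → Linked R xs
  Linked-++⁻ˡ []           _        = []
  Linked-++⁻ˡ (x ∷ [])     _        = [-]
  Linked-++⁻ˡ (x ∷ y ∷ xs) (r ∷ rs) = r ∷ Linked-++⁻ˡ (y ∷ xs) rs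

  Unique-++⁻ˡ : ∀ (xs : List X) {ys} → Unique (xs ++ ys) → Unique xs
  Unique-++⁻ˡ []       _        = []
  Unique-++⁻ˡ (x ∷ xs) (p ∷ ps) = ++⁻ˡ xs p ∷ Unique-++⁻ˡ xs ps

  -- A walk that returns to `x` is cut at the first return, so that `x` is not among the inner
  -- vertices of the resulting closed walk.
  first-occurrence : DecidableEquality X → ∀ x xs →
    All (x ≢_) xs ⊎ (∃[ ps ] ∃[ qs ] (xs ≡ ps ++ x ∷ qs × All (x ≢_) ps))
  first-occurrence _≟ₓ_ x [] = inj₁ []
  first-occurrence _≟ₓ_ x (y ∷ xs) with x ≟ₓ y | first-occurrence _≟ₓ_ x xs
  ... | yes refl | _                              = inj₂ ([] , xs , refl , [])
  ... | no x≢y   | inj₁ x∉xs                      = inj₁ (x≢y ∷ x∉xs)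
  ... | no x≢y   | inj₂ (ps , qs , refl , x∉ps)   = inj₂ (y ∷ ps , qs , refl , x≢y ∷ x∉ps)

-- Non-backtracking walks in graphs.

module _ {V : Set} (G : Graph V) where

  -- The non-backtracking walks, as nonempty lists of vertices.
  data Trail : List V → Set where
    [-]    : ∀ {x} → Trail [ x ]
    edge   : ∀ {x y} → Adj G x y → Trail (x ∷ y ∷ [])
    extend : ∀ {x y z zs} → Adj G x y → x ≢ z → Trail (y ∷ z ∷ zs) → Trail (x ∷ y ∷ z ∷ zs)

module _ {V : Set} {G : Graph V} where

  trail-linked : ∀ {xs} → Trail G xs → Linked (Adj G) xs
  trail-linked [-]            = [-]
  trail-linked (edge e)       = e ∷ [-]
  trail-linked (extend e _ t) = e ∷ trail-linked t

  trail-tail : ∀ {x y ys} → Trail G (x ∷ y ∷ ys) → Trail G (y ∷ ys)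
  trail-tail (edge _)       = [-]
  trail-tail (extend _ _ t) = t

  trail-init : ∀ x xs {y} → Trail G (x ∷ xs ∷ʳ y) → Trail G (x ∷ xs)
  trail-init x []           _              = [-]
  trail-init x (z ∷ [])     (extend e _ _) = edge e
  trail-init x (z ∷ w ∷ ws) (extend e n t) = extend e n (trail-init z (w ∷ ws) t)

  -- The two trails share an edge, so that no new backtracking can arise.
  trail-glue : ∀ ps {x y qs} → Trail G (ps ++ x ∷ y ∷ []) → Trail G (x ∷ y ∷ qs) →
               Trail G (ps ++ x ∷ y ∷ qs)
  trail-glue []           _              t = t
  trail-glue (p ∷ [])     (extend e n s) t = extend e n t
  trail-glue (p ∷ q ∷ []) (extend e n s) t = extend e n (trail-glue (q ∷ []) s t)
  trail-glue (p ∷ q ∷ r ∷ ps) (extend e n s) t = extend e n (trail-glue (q ∷ r ∷ ps) s t)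

  trail-map : {φ : V → V} → (∀ {x y} → φ x ≡ φ y → x ≡ y) →
              (∀ {x y} → Adj G x y → Adj G (φ x) (φ y)) →
              ∀ {xs} → Trail G xs → Trail G (map φ xs)
  trail-map inj hom [-]            = [-]
  trail-map inj hom (edge e)       = edge (hom e)
  trail-map inj hom (extend e n t) = extend (hom e) (λ eq → n (inj eq)) (trail-map inj hom t)

  -- Edges are prepended one at a time to a reduced walk; if the new edge would be traversed back at
  -- once, both traversals cancel.
  star⇒trail : DecidableEquality V → ∀ {u v} → Star (Adj G) u v →
               u ≡ v ⊎ (∃[ ws ] Trail G (u ∷ ws ∷ʳ v))
  star⇒trail _≟ᵥ_ ε = inj₁ refl
  star⇒trail _≟ᵥ_ {u} {v} (_◅_ {j = y} e es) with star⇒trail _≟ᵥ_ es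
  ... | inj₁ refl = inj₂ ([] , edge e)
  ... | inj₂ ([] , t) with u ≟ᵥ v
  ...   | yes u≡v = inj₁ u≡v
  ...   | no  u≢v = inj₂ ([ y ] , extend e u≢v t)
  star⇒trail _≟ᵥ_ {u} {v} (_◅_ {j = y} e es) | inj₂ (z ∷ ws , t) with u ≟ᵥ z
  ...   | yes refl = inj₂ (ws , trail-tail t)
  ...   | no  u≢z  = inj₂ (y ∷ z ∷ ws , extend e u≢z t)

  -- If the first vertex recurred, the walk up to its first return would be a cycle: the vertices in
  -- between are distinct by induction, and returns after one or two steps are excluded by
  -- irreflexivity and by the absence of backtracking.
  acyclic⇒trail-unique : DecidableEquality V → Acyclic G → ∀ {xs} → Trail G xs → Unique xs
  acyclic⇒trail-unique _≟ᵥ_ acyc [-] = [] ∷ []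
  acyclic⇒trail-unique _≟ᵥ_ acyc (edge e) =
    ((λ { refl → adj-irrefl G e }) ∷ []) ∷ [] ∷ []
  acyclic⇒trail-unique _≟ᵥ_ acyc {x ∷ xs} t@(extend e x≢z s)
    with acyclic⇒trail-unique _≟ᵥ_ acyc s | first-occurrence _≟ᵥ_ x xs
  ... | unique | inj₁ x∉xs = x∉xs ∷ unique
  ... | unique | inj₂ ([] , qs , refl , _) = ⊥-elim (adj-irrefl G e)
  ... | unique | inj₂ (_ ∷ [] , qs , refl , _) = contradiction refl x≢z
  ... | unique | inj₂ (ps@(_ ∷ _ ∷ _) , qs , refl , x∉ps) =
    ⊥-elim (acyc x ps
      ( x∉ps ∷ Unique-++⁻ˡ ps unique
      , s≤s (s≤s (s≤s z≤n))
      , Linked-++⁻ˡ (x ∷ ps ∷ʳ x)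
          (subst (Linked (Adj G)) (cong (x ∷_) (sym (++-assoc ps [ x ] qs))) (trail-linked t))))

  -- Involutions of forests.

  module _ (_≟ᵥ_ : DecidableEquality V) (acyc : Acyclic G)
           {φ : V → V} (φ-invol : Involutive _≡_ φ)
           (φ-hom : ∀ {u v} → Adj G u v → Adj G (φ u) (φ v))
           (φ-nofix : ∀ v → φ v ≢ v) (φ-noflip : ∀ v → ¬ Adj G v (φ v)) where

    private
      φ-injective : ∀ {x y} → φ x ≡ φ y → x ≡ y
      φ-injective {x} {y} eq = trans (sym (φ-invol x)) (trans (cong φ eq) (φ-invol y))

      -- The trail and its image under φ form a trail from v back to v.
      not-closing : ∀ ps {v y zs z} → v ∷ y ∷ zs ≡ v ∷ ps ∷ʳ z → z ≢ φ y →
                    ¬ Trail G (v ∷ y ∷ zs ∷ʳ φ v)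
      not-closing ps {v} {y} {zs} {z} eq z≢φy t
        -- By `eq`, `z` is the vertex just before `φ v`, and `φ y` is the one just after it in the
        -- image; hence `z≢φy` rules out backtracking at the joint.
        with acyclic⇒trail-unique _≟ᵥ_ acyc (trail-glue (v ∷ ps) t′ (extend z–φv z≢φy φt))
        where
        t′ : Trail G (v ∷ ps ++ z ∷ φ v ∷ [])
        t′ = subst (Trail G) (trans (cong (_∷ʳ φ v) eq) (cong (v ∷_) (++-assoc ps [ z ] _))) t
        φt : Trail G (map φ (v ∷ y ∷ zs ∷ʳ φ v))
        φt = trail-map φ-injective φ-hom t
        last-adj : ∀ qs → Linked (Adj G) (qs ++ z ∷ φ v ∷ []) → Adj G z (φ v)
        last-adj []           (e ∷ _) = e
        last-adj (_ ∷ [])     (_ ∷ l) = last-adj [] l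
        last-adj (_ ∷ q ∷ qs) (_ ∷ l) = last-adj (q ∷ qs) l
        z–φv : Adj G z (φ v)
        z–φv = last-adj (v ∷ ps) (trail-linked t′)
      ... | v∉ ∷ _ = All.lookup v∉ v∈ refl
        where
        v∈ : v ∈ₗ ps ++ z ∷ map φ (v ∷ y ∷ zs ∷ʳ φ v)
        v∈ = ∈-++⁺ʳ ps (there (subst (v ∈ₗ_) (sym (map-++ φ (v ∷ y ∷ zs) [ φ v ]))
               (∈-++⁺ʳ (map φ (v ∷ y ∷ zs)) (here (sym (φ-invol v))))))

      -- Stripping both ends of a list is not structural recursion, so `n` bounds the number of
      -- inner vertices and decreases instead.
      no-trail : ∀ n v ws → length ws ≤ n → ¬ Trail G (v ∷ ws ∷ʳ φ v)
      no-trail n v ws ws≤n t with initLast ws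
      no-trail n v _ ws≤n (edge e) | [] = φ-noflip v e
      no-trail n v _ ws≤n t | [] ∷ʳ′ z = not-closing [] refl (λ eq → φ-nofix z (sym eq)) t
      no-trail (suc n) v _ (s≤s ws≤n) t | (y ∷ zs) ∷ʳ′ z with z ≟ᵥ φ y
      ... | no z≢φy  = not-closing (y ∷ zs) refl z≢φy t
      -- Here `φ` exchanges the outermost inner vertices, and the inner walk again joins a vertex to
      -- its image.
      ... | yes refl = no-trail n y zs (≤-trans (length-++-≤ˡ zs) ws≤n)
                         (trail-init y (zs ∷ʳ z) (trail-tail t))

    fixed-point-free⇒moves-components : ∀ v → ¬ Star (Adj G) v (φ v)
    fixed-point-free⇒moves-components v p with star⇒trail _≟ᵥ_ p
    ... | inj₁ v≡φv     = φ-nofix v (sym v≡φv)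
    ... | inj₂ (ws , t) = no-trail (length ws) v ws ≤-refl t

-- Components of a disjoint union of trees.

module _ {V : Set} {c : ℕ} {G : Graph V} {T : Fin c → Graph V}
         (D : IsDisjointUnionOfTrees G T) where
  open IsDisjointUnionOfTrees D

  component-unique : ∀ {i j v} → Vertex (T i) v → Vertex (T j) v → i ≡ j
  component-unique {i} {j} p q = decidable-stable (i ≟ j) λ i≢j → disjoint i≢j (p , q)

  -- The tree that carries the edge shares the vertex `u` with `T i`, so disjointness identifies the
  -- two.
  adj-in-component : ∀ {i u v} → Vertex (T i) u → Adj G u v → Adj (T i) u v
  adj-in-component p e with Equivalence.to edges e
  ... | j , e′ with component-unique p (proj₁ (adj-vertex (T j) e′))
  ...   | refl = e′

  linked-in-component : ∀ {i x xs} → Vertex (T i) x → Linked (Adj G) (x ∷ xs) →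
                        Linked (Adj (T i)) (x ∷ xs)
  linked-in-component p [-]     = [-]
  linked-in-component {i} p (e ∷ es) =
    let e′ = adj-in-component p e
    in  e′ ∷ linked-in-component (proj₂ (adj-vertex (T i) e′)) es

  disjointUnionOfTrees⇒acyclic : Acyclic G
  disjointUnionOfTrees⇒acyclic x [] (_ , s≤s () , _)
  disjointUnionOfTrees⇒acyclic x vs@(_ ∷ _) (unique , long , es@(e ∷ _)) =
    let i , x∈Tᵢ = Equivalence.to vertices (proj₁ (adj-vertex G e))
    in  IsTree.acyclic (trees i) x vs (unique , long , linked-in-component x∈Tᵢ es)

  component-connected : ∀ {i u v} → Vertex (T i) u → Vertex (T i) v → Star (Adj G) u v
  component-connected {i} p q =
    Star.map (λ e → Equivalence.from edges (i , e)) (IsTree.connected (trees i) p q)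

-- Copies of letters, inverse words and labelled paths.

module _ {A : Set} where

  1⊗-injective : ∀ {a b : A} → (1⊗ a) ≡ (1⊗ b) → a ≡ b
  1⊗-injective refl = refl

  ⊗1-injective : ∀ {a b : A} → (a ⊗1) ≡ (b ⊗1) → a ≡ b
  ⊗1-injective refl = refl

  copy-≟ : DecidableEquality A → DecidableEquality (Copy A)
  copy-≟ _≟ₐ_ (1⊗ a) (1⊗ b) with a ≟ₐ b
  ... | yes refl = yes refl
  ... | no a≢b   = no λ eq → a≢b (1⊗-injective eq)
  copy-≟ _≟ₐ_ (a ⊗1) (b ⊗1) with a ≟ₐ b
  ... | yes refl = yes refl
  ... | no a≢b   = no λ eq → a≢b (⊗1-injective eq)
  copy-≟ _≟ₐ_ (1⊗ a) (b ⊗1) = no λ ()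
  copy-≟ _≟ₐ_ (a ⊗1) (1⊗ b) = no λ ()

  inverse-∷ : ∀ (θ : A → A) a w → inverse θ (a ∷ w) ≡ inverse θ w ∷ʳ θ a
  inverse-∷ θ a w = unfold-reverse (θ a) (map θ w)

  inverse-involutive : ∀ {θ : A → A} → Involutive _≡_ θ → Involutive _≡_ (inverse θ)
  inverse-involutive {θ} θ-invol w = begin
    reverse (map θ (reverse (map θ w)))  ≡⟨ cong reverse (reverse-map θ (map θ w)) ⟩
    reverse (reverse (map θ (map θ w)))  ≡⟨ reverse-involutive (map θ (map θ w)) ⟩
    map θ (map θ w)                      ≡⟨ map-∘ w ⟨
    map (λ a → θ (θ a)) w                ≡⟨ map-cong θ-invol w ⟩
    map (λ a → a) w                      ≡⟨ map-id w ⟩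
    w                                    ∎
    where open ≡-Reasoning

  module _ {Q : Set} {E : LabelledGraph Q A} where

    path-++ : ∀ {i j k u v} → Path E i u j → Path E j v k → Path E i (u ++ v) k
    path-++ []      q = q
    path-++ (e ∷ p) q = e ∷ path-++ p q

    path-split : ∀ {i k} u {v} → Path E i (u ++ v) k → ∃[ j ] (Path E i u j × Path E j v k)
    path-split []      q       = _ , [] , q
    path-split (a ∷ u) (e ∷ p) = let j , p₁ , p₂ = path-split u p in j , e ∷ p₁ , p₂

opposite-unique : ∀ {i j : Fin 2} → i ≢ j → i ≡ opposite j
opposite-unique {zero}     {zero}     i≢j = contradiction refl i≢j
opposite-unique {zero}     {suc zero} i≢j = refl
opposite-unique {suc zero} {zero}     i≢j = refl
opposite-unique {suc zero} {suc zero} i≢j = contradiction refl i≢j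

-- Paths in the parity graph and the parity of words.

module ParityPaths {A : Set} {S : Language A} (bi : Biextendable S)
                   {T : Fin 2 → Graph (Copy A)}
                   (D : IsDisjointUnionOfTrees (extensionGraph (Biextendable.factorial bi) []) T)
                   where
  open Biextendable bi
  open Factorial factorial
  open IsDisjointUnionOfTrees D

  private
    E : LabelledGraph (Fin 2) A
    E = parityGraph T

    locate : ∀ v → ∃[ i ] Vertex (T i) v
    locate (1⊗ a) = Equivalence.to vertices (letters a)
    locate (a ⊗1) = Equivalence.to vertices (letters a)

  treeOf : Copy A → Fin 2
  treeOf v = proj₁ (locate v)

  treeOf-vertex : ∀ v → Vertex (T (treeOf v)) v
  treeOf-vertex v = proj₂ (locate v)

  vertex⇒treeOf : ∀ {i v} → Vertex (T i) v → i ≡ treeOf v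
  vertex⇒treeOf p = component-unique D p (treeOf-vertex _)

  source target : A → Fin 2
  source a = treeOf (a ⊗1)
  target a = treeOf (1⊗ a)

  target≡source : ∀ {a b} → a ∷ b ∷ [] ∈ S → target a ≡ source b
  target≡source {a} {b} ab∈S =
    vertex⇒treeOf (proj₂ (adj-vertex (T _)
      (adj-in-component D {v = b ⊗1} (treeOf-vertex (1⊗ a)) ab∈S)))

  edge-ends : ∀ {i a j} → E i a j → i ≡ source a × j ≡ target a
  edge-ends ((b , e) , (c , f)) =
    vertex⇒treeOf (proj₂ (adj-vertex (T _) e)) , vertex⇒treeOf (proj₁ (adj-vertex (T _) f))

  -- A two-sided extension of the one-letter word provides a neighbour for each of the two copies of
  -- `a`.
  letter-edge : ∀ a → E (source a) a (target a)
  letter-edge a with extendable [ a ] (letters a)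
  ... | (b , c) , bac∈S =
      (b , adj-sym (T _) (adj-in-component D {v = 1⊗ b} (treeOf-vertex (a ⊗1))
             (factors [] (b ∷ a ∷ []) [ c ] bac∈S)))
    , (c , adj-in-component D {v = c ⊗1} (treeOf-vertex (1⊗ a)) (factors [ b ] (a ∷ c ∷ []) [] bac∈S))

  path-exists : ∀ a w → a ∷ w ∈ S → ∃[ j ] Path E (source a) (a ∷ w) j
  path-exists a []      _ = target a , letter-edge a ∷ []
  path-exists a (b ∷ w) abw∈S =
    let j , p = path-exists b w
          (factors [ a ] (b ∷ w) [] (subst (λ z → a ∷ z ∈ S) (sym (++-identityʳ (b ∷ w))) abw∈S))
        eq = target≡source (factors [] (a ∷ b ∷ []) w abw∈S)
    in  j , letter-edge a ∷ subst (λ k → Path E k (b ∷ w) j) (sym eq) p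

  path-deterministic : ∀ {i j k w} → Path E i w j → Path E i w k → j ≡ k
  path-deterministic []      []      = refl
  path-deterministic (e ∷ p) (f ∷ q)
    with trans (proj₂ (edge-ends e)) (sym (proj₂ (edge-ends f)))
  ... | refl = path-deterministic p q

  -- The first letter determines the start, whereas the empty word labels a path at each vertex.
  path-ends-unique : ∀ {i j k l} w → w ≢ [] → Path E i w j → Path E k w l → (i , j) ≡ (k , l)
  path-ends-unique []      w≢[] p q = contradiction refl w≢[]
  path-ends-unique (a ∷ w) w≢[] p@(e ∷ _) q@(f ∷ _)
    with trans (proj₁ (edge-ends e)) (sym (proj₁ (edge-ends f)))
  ... | refl = cong (_ ,_) (path-deterministic p q)

  -- A path labelled by the whole word, split after `u`, passes through a vertex that uniqueness of
  -- ends identifies with both `j` and `k`.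
  paths-compose : ∀ {i j k l} u v → u ≢ [] → v ≢ [] → Path E i u j → Path E k v l →
                  u ++ v ∈ S → j ≡ k
  paths-compose []      v u≢[] v≢[] p q uv∈S = contradiction refl u≢[]
  paths-compose (a ∷ u) v u≢[] v≢[] p q uv∈S
    with path-split (a ∷ u) (proj₂ (path-exists a (u ++ v) uv∈S))
  ... | m , p′ , q′ = trans (cong proj₂ (path-ends-unique (a ∷ u) u≢[] p p′))
                            (cong proj₁ (path-ends-unique v v≢[] q′ q))

  even-edge : ∀ {i a j} → E i a j → EvenLetter T a → i ≡ j
  even-edge e (k , p , q) =
    let i≡ , j≡ = edge-ends e
    in  trans i≡ (trans (sym (vertex⇒treeOf q)) (trans (vertex⇒treeOf p) (sym j≡)))

  odd-edge : ∀ {i a j} → E i a j → OddLetter T a → i ≢ j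
  odd-edge {a = a} e odd refl =
    let i≡ , j≡ = edge-ends e
    in  odd ( source a
            , subst (λ k → Vertex (T k) (1⊗ a)) (trans (sym j≡) i≡) (treeOf-vertex (1⊗ a))
            , treeOf-vertex (a ⊗1))

  oddCount : List A → ℕ
  oddCount w = length (filter (oddLetter? factorial D) w)

  oddCount-even : ∀ {a} w → EvenLetter T a → oddCount (a ∷ w) ≡ oddCount w
  oddCount-even w even =
    cong length (filter-reject (oddLetter? factorial D) {xs = w} (λ odd → odd even))

  oddCount-odd : ∀ {a} w → OddLetter T a → oddCount (a ∷ w) ≡ suc (oddCount w)
  oddCount-odd w odd = cong length (filter-accept (oddLetter? factorial D) {xs = w} odd)

  -- Oddness of `c` is expressed as evenness of its successor, so that an odd letter simply
  -- exchanges the two alternatives.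
  ParityRelated : Fin 2 → Fin 2 → ℕ → Set
  ParityRelated i j c = (i ≡ j × 2 ∣ c) ⊎ (i ≢ j × 2 ∣ suc c)

  parityRelated-suc : ∀ {i j k c} → i ≢ j → ParityRelated j k c → ParityRelated i k (suc c)
  parityRelated-suc i≢j (inj₁ (refl , 2∣c))  = inj₂ (i≢j , ∣m∣n⇒∣m+n ∣-refl 2∣c)
  parityRelated-suc i≢j (inj₂ (j≢k , 2∣1+c)) =
    -- Both `i` and `k` differ from `j`, hence both are its opposite.
    inj₁ (trans (opposite-unique i≢j) (sym (opposite-unique λ k≡j → j≢k (sym k≡j))) , 2∣1+c)

  path-parity : ∀ {i w j} → Path E i w j → ParityRelated i j (oddCount w)
  path-parity [] = inj₁ (refl , 2 ∣0)
  path-parity {i} {_} {k} (_∷_ {a = a} {w = w} e p) = step (evenLetter? factorial D a)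
    where
    step : Dec (EvenLetter T a) → ParityRelated i k (oddCount (a ∷ w))
    step (yes even) = subst (ParityRelated i k) (sym (oddCount-even w even))
      (subst (λ m → ParityRelated m k (oddCount w)) (sym (even-edge e even)) (path-parity p))
    step (no odd) = subst (ParityRelated i k) (sym (oddCount-odd w odd))
      (parityRelated-suc (odd-edge e odd) (path-parity p))

  closed-path⇒even : ∀ {i w} → Path E i w i → 2 ∣ oddCount w
  closed-path⇒even p with path-parity p
  ... | inj₁ (_ , even)  = even
  ... | inj₂ (i≢i , _)   = contradiction refl i≢i

  even⇒closed-path : ∀ {i w j} → Path E i w j → 2 ∣ oddCount w → i ≡ j
  even⇒closed-path {w = w} p even with path-parity p
  ... | inj₁ (i≡j , _)  = i≡j
  ... | inj₂ (_ , 2∣1+c)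
    -- If 2 divided two consecutive numbers, it would divide 1.
    with ∣1⇒≡1 (∣m+n∣m⇒∣n (subst (2 ∣_) (+-comm 1 (oddCount w)) 2∣1+c) even)
  ...   | ()

-- Inversion exchanges the two trees.

module SpecularParity {n : ℕ} {A : Set} (A↔Fin : A ↔ Fin n)
                      {θ : A → A} (θ-invol : Involutive _≡_ θ)
                      {S : Language A} (spec : IsSpecular θ S)
                      {T : Fin 2 → Graph (Copy A)}
                      (D : IsDisjointUnionOfTrees
                             (extensionGraph (IsTreeSet.factorial (IsSpecular.treeSet spec)) []) T)
                      where
  open IsSpecular spec
  open IsLaminary laminary using (reduced; inverse-closed)
  open IsTreeSet treeSet using (biextendable; factorial)
  open ParityPaths biextendable D

  flip : Copy A → Copy A
  flip (1⊗ a) = θ a ⊗1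
  flip (a ⊗1) = 1⊗ θ a

  flip-involutive : Involutive _≡_ flip
  flip-involutive (1⊗ a) = cong 1⊗_ (θ-invol a)
  flip-involutive (a ⊗1) = cong _⊗1 (θ-invol a)

  -- An edge is a two-letter word of `S` and its image is the inverse word; the exchange of the two
  -- sides accounts for the reversal of the letters.
  flip-adj : ∀ u v → ExtAdj S [] u v → ExtAdj S [] (flip u) (flip v)
  flip-adj (1⊗ a) (b ⊗1) ab∈S = inverse-closed (a ∷ b ∷ []) ab∈S
  flip-adj (b ⊗1) (1⊗ a) ab∈S = inverse-closed (a ∷ b ∷ []) ab∈S

  flip-no-fixed-point : ∀ v → flip v ≢ v
  flip-no-fixed-point (1⊗ _) ()
  flip-no-fixed-point (_ ⊗1) ()

  flip-no-flipped-edge : ∀ v → ¬ ExtAdj S [] v (flip v)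
  flip-no-flipped-edge (1⊗ a) aθa∈S = reduced _ aθa∈S [] a [] refl
  flip-no-flipped-edge (a ⊗1) θaa∈S =
    reduced _ θaa∈S [] (θ a) [] (cong (λ b → θ a ∷ b ∷ []) (sym (θ-invol a)))

  -- A common tree would contain a walk from `v` to `flip v`, and with two trees in all a different
  -- one is the opposite one.
  treeOf-flip : ∀ v → treeOf (flip v) ≡ opposite (treeOf v)
  treeOf-flip v = opposite-unique λ eq →
    fixed-point-free⇒moves-components {G = extensionGraph factorial []} (copy-≟ (inj⇒≟ (↔⇒↣ A↔Fin)))
      (disjointUnionOfTrees⇒acyclic D) flip-involutive (λ {u} {v} → flip-adj u v)
      flip-no-fixed-point flip-no-flipped-edge v
      (component-connected D (treeOf-vertex v)
        (subst (λ i → Vertex (T i) (flip v)) eq (treeOf-vertex (flip v))))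

  -- The source of `θ a` is the tree of `flip (1⊗ a)` and its target is the tree of `flip (a ⊗1)`.
  edge-inverse : ∀ {i a j} → parityGraph T i a j → parityGraph T (opposite j) (θ a) (opposite i)
  edge-inverse {a = a} e with edge-ends e
  ... | refl , refl
    rewrite sym (treeOf-flip (a ⊗1)) | sym (treeOf-flip (1⊗ a)) = letter-edge (θ a)

  path-inverse : ∀ {i w j} → Path (parityGraph T) i w j →
                 Path (parityGraph T) (opposite j) (inverse θ w) (opposite i)
  path-inverse [] = []
  path-inverse (_∷_ {a = a} {w = w} e p) =
    subst (λ z → Path (parityGraph T) _ z _) (sym (inverse-∷ θ a w))
      (path-++ (path-inverse p) (edge-inverse e ∷ []))

  inverse-pathLabels : ∀ {i j w} → w ∈ PathLabels T S i j →
                       inverse θ w ∈ PathLabels T S (opposite j) (opposite i)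
  inverse-pathLabels (w∈S , p) = inverse-closed _ w∈S , path-inverse p

-- Partition, composition, parity and inversion of the sets of path labels.

proposition4p11 : (n : ℕ) (A : Set) → A ↔ Fin n →
    (θ : A → A) → Involutive _≡_ θ →
    (S : Language A) (spec : IsSpecular θ S) →
    let F = IsTreeSet.factorial (IsSpecular.treeSet spec) in
    (T : Fin 2 → Graph (Copy A)) (D : IsDisjointUnionOfTrees (extensionGraph F []) T) →
    let S[_,_] = PathLabels T S in
    IsPartition (λ ((i , j) : Fin 2 × Fin 2) → S[ i , j ] ∖ ｛ [] ｝) (S ∖ ｛ [] ｝)
    × (∀ i j k l u v → u ∈ S[ i , j ] ∖ ｛ [] ｝ → v ∈ S[ k , l ] ∖ ｛ [] ｝ → u ++ v ∈ S → j ≡ k)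
    × S[ zero , zero ] ∪ S[ suc zero , suc zero ] ≐ EvenWords F D
    × (∀ i j → Inverses θ S[ i , j ] ≐ S[ opposite j , opposite i ])
proposition4p11 n A A↔Fin θ θ-invol S spec T D =
    (((λ (_ , (w∈S , _) , w≢[]) → w∈S , w≢[]) , covered _) , disjoint)
  , (λ i j k l u v ((_ , p) , u≢[]) ((_ , q) , v≢[]) →
       paths-compose u v (λ eq → u≢[] (sym eq)) (λ eq → v≢[] (sym eq)) p q)
  , (closed⇒even , even⇒closed _)
  , λ i j → (λ { (_ , y∈ , refl) → inverse-pathLabels y∈ }) , inverted
  where
  open ParityPaths (IsTreeSet.biextendable (IsSpecular.treeSet spec)) D
  open SpecularParity A↔Fin θ-invol spec D

  S[_,_] : Fin 2 → Fin 2 → Language A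
  S[_,_] = PathLabels T S

  covered : ∀ w → w ∈ S ∖ ｛ [] ｝ → ∃[ (i , j) ] w ∈ S[ i , j ] ∖ ｛ [] ｝
  covered []      (_ , []≢[])   = contradiction refl []≢[]
  covered (a ∷ w) (aw∈S , aw≢[]) =
    let j , p = path-exists a w aw∈S in (source a , j) , (aw∈S , p) , aw≢[]

  disjoint : ∀ p q → p ≢ q → ∀ {w} →
             ¬ (w ∈ S[ proj₁ p , proj₂ p ] ∖ ｛ [] ｝ × w ∈ S[ proj₁ q , proj₂ q ] ∖ ｛ [] ｝)
  disjoint _ _ p≢q (((_ , p) , w≢[]) , ((_ , q) , _)) =
    p≢q (path-ends-unique _ (λ eq → w≢[] (sym eq)) p q)

  closed⇒even : ∀ {w} → w ∈ S[ zero , zero ] ∪ S[ suc zero , suc zero ] → w ∈ EvenWords _ D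
  closed⇒even (inj₁ (w∈S , p)) = w∈S , closed-path⇒even p
  closed⇒even (inj₂ (w∈S , p)) = w∈S , closed-path⇒even p

  even⇒closed : ∀ w → w ∈ EvenWords _ D → w ∈ S[ zero , zero ] ∪ S[ suc zero , suc zero ]
  -- The empty word labels a closed path at either vertex; the choice of `zero` is arbitrary.
  even⇒closed [] (w∈S , _) = inj₁ (w∈S , [])
  even⇒closed (a ∷ w) (w∈S , even) with path-exists a w w∈S
  ... | j , p = closed (source a) j p (even⇒closed-path p even)
    where
    closed : ∀ i j → Path (parityGraph T) i (a ∷ w) j → i ≡ j →
             a ∷ w ∈ S[ zero , zero ] ∪ S[ suc zero , suc zero ]
    closed zero       _ p refl = inj₁ (w∈S , p)
    closed (suc zero) _ p refl = inj₂ (w∈S , p)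

  -- The forward inclusion applied to `w` itself suffices, because inversion of words and `opposite`
  -- are both involutive.
  inverted : ∀ {i j w} → w ∈ S[ opposite j , opposite i ] → w ∈ Inverses θ S[ i , j ]
  inverted {i} {j} {w} w∈ =
      inverse θ w
    , (let w⁻¹∈ = inverse-pathLabels w∈ in
       subst (λ k → inverse θ w ∈ S[ k , j ]) (opposite-involutive i)
         (subst (λ k → inverse θ w ∈ S[ opposite (opposite i) , k ]) (opposite-involutive j) w⁻¹∈))
    , sym (inverse-involutive θ-invol w)
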